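{- Fix $n\ge 1$ and variables $x_1,\dots,x_n$ ranging over the natural numbers. Each of the constraint systems $\mathbf{AD}$, $\mathbf{NA}$ and $\mathbf{DV}$ over $x_1,\dots,x_n$, ordered by the entailment relation $\preceq$, is a better quasi-ordering.
   Context: Let $\mathcal N=\{0,1,2,\dots\}$. A configuration is a tuple $(a_1,\dots,a_n)\in\mathcal N^n$. Constraint systems: $\mathbf{AD}$ is the set of finite conjunctions of constraints each of the form $x_{i_1}+\cdots+x_{i_k}\ge b$, where $x_{i_1},\dots,x_{i_k}$ are distinct variables of $\{x_1,\dots,x_n\}$ and $b\in\mathcal N$. $\mathbf{NA}$ is the special case where $k=1$ in every conjunct. $\mathbf{DV}$ is the special case where the sets of variables occurring in the different conjuncts are pairwise disjoint. The denotation $[\![\phi]\!]\subseteq\mathcal N^n$ of a constraint $\phi$ is the set of configurations satisfying it (with $x_i$ interpreted as $a_i$). Entailment: $\phi_1\preceq\phi_2$ iff $[\![\phi_2]\!]\subseteq[\![\phi_1]\!]$. Better quasi-orderings: let $\mathcal N^{<\omega}$ (resp. $\mathcal N^{\omega}$) be the set of finite (resp. infinite) strictly increasing sequences over $\mathcal N$. For $s\in\mathcal N^{<\omega}$, $\lambda(s)$ is the set of numbers occurring in $s$, and if $s$ is nonempty, $tail(s)$ is $s$ with its first element deleted. $s_1\ll s_2$ means $s_1$ is a proper prefix of $s_2$; for nonempty $s_1$, $s_1\ll_* s_2$ means $tail(s_1)\ll s_2$. An infinite set $\beta\subseteq\mathcal N^{<\omega}$ is a barrier if (i) there are no $s_1,s_2\in\beta$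 with $\lambda(s_1)\subsetneq\lambda(s_2)$, and (ii) for each $s_2\in\mathcal N^\omega$ there is $s_1\in\beta$ with $s_1\ll s_2$. A quasi-ordering (reflexive transitive relation) $(A,\preceq)$ is a better quasi-ordering if for every barrier $\beta$ and every map $f:\beta\to A$ there are $s_1,s_2\in\beta$ with $s_1\ll_* s_2$ and $f(s_1)\preceq f(s_2)$. -}

module Defs where

open import Axiom.ExcludedMiddle public using (ExcludedMiddle)
open import Data.Empty using (⊥)
open import Data.Fin using (Fin)
open import Data.List using (List; []; _∷_; applyUpTo; length; map; sum)
open import Data.List.Membership.Propositional using (_∈_)
open import Data.List.Relation.Binary.Disjoint.Propositional using (Disjoint)
open import Data.List.Relation.Binary.Prefix.Heterogeneous using (Prefix)
import Data.List.Relation.Binary.Subset.Propositional as List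
open import Data.List.Relation.Unary.All using (All)
open import Data.List.Relation.Unary.AllPairs using (AllPairs)
open import Data.List.Relation.Unary.Linked using (Linked)
open import Data.List.Relation.Unary.Unique.Propositional using (Unique)
open import Data.Nat using (ℕ; suc; _≤_; _<_; _≥_)
open import Data.Product using (Σ; ∃-syntax; _×_; proj₁)
open import Data.Vec using (Vec; lookup)
open import Function using (_on_)
open import Level using (0ℓ)
open import Relation.Binary using (Rel; IsPreorder)
open import Relation.Binary.PropositionalEquality using (_≡_; _≢_)
open import Relation.Nullary using (¬_)
open import Relation.Unary using (Pred; _⊆_)

Configuration : ℕ → Set
Configuration n = Vec ℕ n

-- x_{i₁} + ⋯ + x_{iₖ} ≥ b, where i₁, …, iₖ are distinct and k ≥ 1.
record Conjunct (n : ℕ) : Set where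
  field
    vars     : List (Fin n)
    distinct : Unique vars
    nonempty : 1 ≤ length vars
    bound    : ℕ

open Conjunct public

AD : ℕ → Set
AD n = List (Conjunct n)

IsNA : ∀ {n} → AD n → Set
IsNA = All (λ c → length (vars c) ≡ 1)

IsDV : ∀ {n} → AD n → Set
IsDV = AllPairs (Disjoint on vars)

NA : ℕ → Set
NA n = Σ (AD n) IsNA

DV : ℕ → Set
DV n = Σ (AD n) IsDV

SatisfiesConjunct : ∀ {n} → Configuration n → Conjunct n → Set
SatisfiesConjunct a c = sum (map (lookup a) (vars c)) ≥ bound c

⟦_⟧ : ∀ {n} → AD n → Pred (Configuration n) 0ℓ
⟦ φ ⟧ a = All (SatisfiesConjunct a) φ

infix 4 _≼_ _≼ᴺᴬ_ _≼ᴰⱽ_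

_≼_ : ∀ {n} → Rel (AD n) 0ℓ
φ₁ ≼ φ₂ = ⟦ φ₂ ⟧ ⊆ ⟦ φ₁ ⟧

_≼ᴺᴬ_ : ∀ {n} → Rel (NA n) 0ℓ
_≼ᴺᴬ_ = _≼_ on proj₁

_≼ᴰⱽ_ : ∀ {n} → Rel (DV n) 0ℓ
_≼ᴰⱽ_ = _≼_ on proj₁

-- Elements of 𝒩^{<ω} are lists satisfying Increasing, and elements of
-- 𝒩^ω are functions satisfying Increasingω.
Increasing : Pred (List ℕ) 0ℓ
Increasing = Linked _<_

Increasingω : Pred (ℕ → ℕ) 0ℓ
Increasingω σ = ∀ i → σ i < σ (suc i)

infix 4 _≪_ _≪ω_ _≪⋆_ _λ⊊_

_≪_ : Rel (List ℕ) 0ℓ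
s₁ ≪ s₂ = Prefix _≡_ s₁ s₂ × s₁ ≢ s₂

-- A finite prefix of an infinite sequence is automatically proper.
_≪ω_ : List ℕ → (ℕ → ℕ) → Set
s ≪ω σ = ∃[ k ] s ≡ applyUpTo σ k

_≪⋆_ : Rel (List ℕ) 0ℓ
[]       ≪⋆ s₂ = ⊥
(_ ∷ s₁) ≪⋆ s₂ = s₁ ≪ s₂

-- λ(s₁) ⊊ λ(s₂), the inclusions being between the sets of entries.
_λ⊊_ : Rel (List ℕ) 0ℓ
s₁ λ⊊ s₂ = s₁ List.⊆ s₂ × ¬ (s₂ List.⊆ s₁)

Infinite : Pred (List ℕ) 0ℓ → Set
Infinite β = ¬ (∃[ L ] β ⊆ (_∈ L))

-- Read constructively, the bar condition only speaks about sequences given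
-- by functions, and the classical theory of better quasi-orderings is not
-- available for such barriers; hence excluded middle has to be assumed
-- where results of that theory are stated.
record IsBarrier (β : Pred (List ℕ) 0ℓ) : Set where
  field
    increasing : β ⊆ Increasing
    infinite   : Infinite β
    antichain  : ∀ {s₁ s₂} → β s₁ → β s₂ → ¬ (s₁ λ⊊ s₂)
    bar        : ∀ σ → Increasingω σ → ∃[ s ] (β s × s ≪ω σ)

record IsBetterQuasiOrdering {A : Set} (_≲_ : Rel A 0ℓ) : Set₁ where
  field
    isPreorder : IsPreorder _≡_ _≲_
    better     : ∀ (β : Pred (List ℕ) 0ℓ) → IsBarrier β →
                 ∀ (f : Σ (List ℕ) β → A) →
                 ∃[ s₁ ] ∃[ s₂ ] (proj₁ s₁ ≪⋆ proj₁ s₂ × f s₁ ≲ f s₂)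

{-# OPTIONS --safe #-}

-- Reading off the prefix in β turns a map on a barrier β into a map F on
-- increasing sequences that is continuous: F X depends only on a finite part of
-- X.  By the clopen Ramsey theorem, whether F X ≤ F (tail X) can be made
-- independent of X by passing to an infinite subset, and for ℕ-valued F the
-- answer "no" would give an infinite descent along X, tail X, tail (tail X), ….
-- Doing this for one coordinate after the other makes every finite power of ℕ a
-- better quasi-ordering.  Finally, a constraint is encoded by the vector of its
-- strongest bounds on each of the 2ⁿ sets of variables, and φ₁ ≼ φ₂ holds as soon
-- as the vector of φ₁ is pointwise at most that of φ₂.

module Submission where

open import Defs
open import Axiom.DoubleNegationElimination using (em⇒dne)
open import Data.Bool as Bool using (Bool; true; false; T)
open import Data.Bool.Properties using (¬-not)
open import Data.Empty using (⊥; ⊥-elim)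
open import Data.Fin using (_≟_)
open import Data.Fin.Subset using (Subset; inside; outside)
open import Data.List using (List; []; _∷_; [_]; length; map; filter; applyUpTo; applyDownFrom; cartesianProductWith)
open import Data.List.Extrema.Nat using (max; max≤v⁺; v≤max⁺)
open import Data.List.Membership.Propositional using (_∈_)
import Data.List.Membership.DecPropositional as DecMembership
open import Data.List.Membership.Propositional.Properties using (∈-applyUpTo⁺; ∈-applyUpTo⁻; ∈-cartesianProductWith⁺; ∈-filter⁺; ∈-map⁺)
open import Data.List.Membership.Propositional.Properties.WithK using (unique∧set⇒bag)
open import Data.List.Properties using (∷-injective; length-applyUpTo)
open import Data.List.Relation.Binary.BagAndSetEquality using (∼bag⇒↭)
open import Data.List.Relation.Binary.Permutation.Propositional.Properties using () renaming (map⁺ to ↭-map⁺)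
open import Data.List.Relation.Binary.Prefix.Heterogeneous using (Prefix; []; _∷_)
import Data.List.Relation.Binary.Subset.Propositional as List
open import Data.List.Relation.Unary.All as All using (All; []; _∷_)
import Data.List.Relation.Unary.All.Properties as All
open import Data.List.Relation.Unary.Any as Any using (here; there)
open import Data.Nat using (ℕ; zero; suc; _+_; _⊔_; _≤_; _<_; _≤ᵇ_; z≤n; s≤s; s≤s⁻¹)
open import Data.Nat.ListAction.Properties using (sum-↭)
open import Data.Nat.Properties hiding (_≟_)
open import Data.Product using (Σ; ∃₂; ∃-syntax; _×_; _,_; proj₁; proj₂)
open import Data.Sum using (inj₁; inj₂)
open import Data.Unit using (tt)
open import Data.Vec using ([]; _∷_; tabulate; lookup)
open import Data.Vec.Properties using (lookup∘tabulate; ≡-dec)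
open import Function using (_∘_; id; _on_)
open import Function.Bundles using (mk⇔)
open import Level using (0ℓ)
open import Relation.Binary using (Rel; IsPreorder)
open import Relation.Binary.PropositionalEquality using (_≡_; refl; sym; trans; cong; cong₂; subst; subst₂; isEquivalence)
open import Relation.Nullary using (¬_; Dec; yes; no; does; contradiction)

-- Increasing sequences, subsequences and continuity.

Seq : Set
Seq = ℕ → ℕ

tail : Seq → Seq
tail X = X ∘ suc

-- With `k` as the right summand, entry 0 of `drop k Y` is `Y k` by computation.
drop : ℕ → Seq → Seq
drop k X i = X (i + k)

tail-increasing : ∀ {X} → Increasingω X → Increasingω (tail X)
tail-increasing inc = inc ∘ suc

increasing⇒<-mono : ∀ {X} → Increasingω X → ∀ {i j} → i < j → X i < X j
increasing⇒<-mono inc {i} {suc j} i<1+j with m<1+n⇒m<n∨m≡n i<1+j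
... | inj₁ i<j  = <-trans (increasing⇒<-mono inc i<j) (inc j)
... | inj₂ refl = inc j

increasing⇒≤-mono : ∀ {X} → Increasingω X → ∀ {i j} → i ≤ j → X i ≤ X j
increasing⇒≤-mono {X} inc i≤j with m≤n⇒m<n∨m≡n i≤j
... | inj₁ i<j  = <⇒≤ (increasing⇒<-mono inc i<j)
... | inj₂ refl = ≤-refl

increasing⇒<-cancel : ∀ {X} → Increasingω X → ∀ {i j} → X i < X j → i < j
increasing⇒<-cancel inc Xi<Xj = ≰⇒> λ j≤i → <⇒≱ Xi<Xj (increasing⇒≤-mono inc j≤i)

infix 4 _⊑_

-- For increasing sequences, inclusion of ranges amounts to being a subsequence, and no monotone
-- index map has to be carried along.
_⊑_ : Rel Seq 0ℓ
X ⊑ H = ∀ i → ∃[ j ] X i ≡ H j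

⊑-refl : ∀ {X} → X ⊑ X
⊑-refl i = i , refl

⊑-trans : ∀ {X Y Z} → X ⊑ Y → Y ⊑ Z → X ⊑ Z
⊑-trans X⊑Y Y⊑Z i with j , Xi≡Yj ← X⊑Y i with k , Yj≡Zk ← Y⊑Z j = k , trans Xi≡Yj Yj≡Zk

tail-⊑ : ∀ {X H} → X ⊑ H → tail X ⊑ H
tail-⊑ X⊑H = X⊑H ∘ suc

drop-0-⊑ : ∀ {X H} → X ⊑ H → drop 0 X ⊑ H
drop-0-⊑ {X} X⊑H i with j , Xi≡Hj ← X⊑H i = j , trans (cong X (+-identityʳ i)) Xi≡Hj

Agree : ℕ → Rel Seq 0ℓ
Agree k Y X = ∀ i → i < k → Y i ≡ X i

Continuous : {A : Set} → (Seq → A) → Set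
Continuous F = ∀ X → Increasingω X →
  ∃[ k ] ∀ Y → Increasingω Y → Agree k Y X → F Y ≡ F X

continuous-∘ : ∀ {A B : Set} (g : A → B) {F : Seq → A} → Continuous F → Continuous (g ∘ F)
continuous-∘ g continuous X inc with k , constant ← continuous X inc =
  k , λ Y Y-inc agree → cong g (constant Y Y-inc agree)

applyDownFrom⇒Agree : ∀ {X Y} k → applyDownFrom Y k ≡ applyDownFrom X k → Agree k Y X
applyDownFrom⇒Agree (suc k) eq i i<1+k with ∷-injective eq | m<1+n⇒m<n∨m≡n i<1+k
... | Yk≡Xk , eq′ | inj₁ i<k  = applyDownFrom⇒Agree k eq′ i i<k
... | Yk≡Xk , eq′ | inj₂ refl = Yk≡Xk

Agree⇒applyUpTo : ∀ {X Y} k → Agree k Y X → applyUpTo Y k ≡ applyUpTo X k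
Agree⇒applyUpTo zero    agree = refl
Agree⇒applyUpTo (suc k) agree =
  cong₂ _∷_ (agree 0 (s≤s z≤n)) (Agree⇒applyUpTo k λ i i<k → agree (suc i) (s≤s i<k))

-- The stem s, of length k, lists the first k entries of Y backwards.
Homogeneous : (Seq → Bool) → (k : ℕ) → List ℕ → Bool → Seq → Set
Homogeneous G k s b H =
  ∀ Y → Increasingω Y → applyDownFrom Y k ≡ s → drop k Y ⊑ H → G Y ≡ b

-- Every reservoir above the stem is allowed, because fusion shrinks the reservoir at each step.
Ramsey : (Seq → Bool) → ℕ → List ℕ → Set
Ramsey G k s = ∀ H → Increasingω H → All (_< H 0) s →
  ∃[ H′ ] Increasingω H′ × H′ ⊑ H × ∃[ b ] Homogeneous G k s b H′

-- The clopen Ramsey theorem.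

module Classical (em : ExcludedMiddle 0ℓ) where

  dne : {P : Set} → ¬ ¬ P → P
  dne = em⇒dne em

  -- Either `true` holds from some point on, or `false` recurs beyond every bound and its
  -- occurrences can be enumerated.
  pigeonhole : (b : ℕ → Bool) → ∃[ e ] Increasingω e × ∃[ c ] ∀ i → b (e i) ≡ c
  pigeonhole b with em {∃[ N ] ∀ i → b (i + N) ≡ true}
  ... | yes (N , eventually-true) = (_+ N) , (λ i → n<1+n (i + N)) , true , eventually-true
  ... | no  ¬eventually-true      = e , e-increasing , false , e-false
    where
    later : ∀ N → ∃[ i ] N ≤ i × b i ≡ false
    later N = dne λ never → ¬eventually-true
      (N , λ i → ¬-not λ bi≡false → never (i + N , m≤n+m N i , bi≡false))

    e : Seq
    e zero    = proj₁ (later 0)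
    e (suc i) = proj₁ (later (suc (e i)))

    e-increasing : Increasingω e
    e-increasing i = proj₁ (proj₂ (later (suc (e i))))

    e-false : ∀ i → b (e i) ≡ false
    e-false zero    = proj₂ (proj₂ (later 0))
    e-false (suc i) = proj₂ (proj₂ (later (suc (e i))))

  -- Fusion: d collects the minima of reservoirs R 0 ⊒ R 1 ⊒ …, where R (suc i)
  -- is homogeneous for the stem extended by d i.
  module Fusion {G : Seq → Bool} {k : ℕ} {s : List ℕ}
                (extend : ∀ m → All (_< m) s → Ramsey G (suc k) (m ∷ s))
                (H : Seq) (H-increasing : Increasingω H) (s<H : All (_< H 0) s) where

    Reservoir : Set
    Reservoir = ∃[ R ] Increasingω R × All (_< R 0) s

    refine : ((R , _) : Reservoir) →
      ∃[ R′ ] Increasingω R′ × R′ ⊑ tail R × ∃[ b ] Homogeneous G (suc k) (R 0 ∷ s) b R′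
    refine (R , inc , s<R) =
      -- `R 0` joins the stem, so the reservoir left above the new stem is `tail R`.
      extend (R 0) s<R (tail R) (tail-increasing inc)
        (inc 0 ∷ All.map (λ m<R → <-trans m<R (inc 0)) s<R)

    reservoir : ℕ → Reservoir
    reservoir zero    = H , H-increasing , s<H
    reservoir (suc i) = R′ , inc′ , All.map (λ m<R → <-trans m<R R<R′) s<R
      where
      R      = proj₁ (reservoir i)
      inc    = proj₁ (proj₂ (reservoir i))
      s<R    = proj₂ (proj₂ (reservoir i))
      R′     = proj₁ (refine (reservoir i))
      inc′   = proj₁ (proj₂ (refine (reservoir i)))
      R′⊑R⁻  = proj₁ (proj₂ (proj₂ (refine (reservoir i))))
      R<R′ : R 0 < R′ 0
      R<R′ with j , R′0≡ ← R′⊑R⁻ 0 = subst (R 0 <_) (sym R′0≡) (increasing⇒<-mono inc (s≤s z≤n))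

    R : ℕ → Seq
    R i = proj₁ (reservoir i)

    d : Seq
    d i = R i 0

    colour : ℕ → Bool
    colour i = proj₁ (proj₂ (proj₂ (proj₂ (refine (reservoir i)))))

    R-homogeneous : ∀ i → Homogeneous G (suc k) (d i ∷ s) (colour i) (R (suc i))
    R-homogeneous i = proj₂ (proj₂ (proj₂ (proj₂ (refine (reservoir i)))))

    R-step : ∀ i → R (suc i) ⊑ tail (R i)
    R-step i = proj₁ (proj₂ (proj₂ (refine (reservoir i))))

    R-antitone : ∀ {i j} → i ≤ j → R j ⊑ R i
    R-antitone {j = zero}  z≤n = ⊑-refl
    R-antitone {i} {suc j} i≤1+j with m≤n⇒m<n∨m≡n i≤1+j
    ... | inj₁ i<1+j = ⊑-trans (⊑-trans (R-step j) (tail-⊑ ⊑-refl)) (R-antitone (s≤s⁻¹ i<1+j))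
    ... | inj₂ refl  = ⊑-refl

    d-increasing : Increasingω d
    d-increasing i with j , d≡ ← R-step i 0 =
      subst (d i <_) (sym d≡) (increasing⇒<-mono (proj₁ (proj₂ (reservoir i))) (s≤s z≤n))

    d⊑H : d ⊑ H
    d⊑H i = R-antitone {0} {i} z≤n 0

    -- The entry `d i` completes the extended stem. Each later entry of `Y` is some `d l` with
    -- `i < l`, hence lies in `R (suc i)`.
    d-homogeneous : ∀ Y → Increasingω Y → applyDownFrom Y k ≡ s → drop k Y ⊑ d →
                    ∀ i → Y k ≡ d i → G Y ≡ colour i
    d-homogeneous Y inc Y≡s Y⊑d i Yk≡di =
      R-homogeneous i Y inc (cong₂ _∷_ Yk≡di Y≡s) rest⊑R
      where
      rest⊑R : drop (suc k) Y ⊑ R (suc i)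
      rest⊑R j
        with l , Y≡dl ← Y⊑d (suc j)
        with i<l ← increasing⇒<-cancel {d} d-increasing {i} {l}
                     (subst₂ _<_ Yk≡di Y≡dl (increasing⇒<-mono {Y} inc {k} {suc (j + k)} (s≤s (m≤n+m k j))))
        with r , dl≡ ← R-antitone i<l 0 =
        r , trans (cong Y (+-suc j k)) (trans Y≡dl dl≡)

    homogeneous : ∃[ H′ ] Increasingω H′ × H′ ⊑ H × ∃[ b ] Homogeneous G k s b H′
    -- The colour still depends on the first entry after the stem; thinning `d` to indices of one
    -- colour removes this.
    homogeneous with e , e-increasing , c , colour≡c ← pigeonhole colour =
      d ∘ e
      , (λ i → increasing⇒<-mono d-increasing (e-increasing i))
      , d⊑H ∘ e
      , c
      , λ Y inc Y≡s Y⊑d∘e →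
          trans (d-homogeneous Y inc Y≡s
                   (λ i → e (proj₁ (Y⊑d∘e i)) , proj₂ (Y⊑d∘e i))
                   (e (proj₁ (Y⊑d∘e 0))) (proj₂ (Y⊑d∘e 0)))
                (colour≡c _)

  -- If the empty stem is not Ramsey, neither is some one-point extension of it,
  -- and so on forever; but G is constant on a finite stem of the sequence
  -- obtained in this way.
  clopen-ramsey : ∀ {G} → Continuous G → Ramsey G 0 []
  clopen-ramsey {G} continuous = dne bad⇒⊥
    where
    module _ (bad : ¬ Ramsey G 0 []) where

      Bad : ℕ → Set
      Bad k = ∃[ s ] ¬ Ramsey G k s

      -- Abstract, since unfolding it while checking stem is prohibitively expensive.
      abstract
        bad-extension : ∀ {k} ((s , _) : Bad k) →
                        ∃[ m ] All (_< m) s × ¬ Ramsey G (suc k) (m ∷ s)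
        bad-extension (s , ¬ramsey) = dne λ none → ¬ramsey
          (Fusion.homogeneous λ m s<m → dne λ ¬ramsey′ → none (m , s<m , ¬ramsey′))

      stem : ∀ k → Bad k
      stem zero    = [] , bad
      stem (suc k) with m , _ , ¬ramsey ← bad-extension (stem k) = m ∷ proj₁ (stem k) , ¬ramsey

      M : Seq
      M k = proj₁ (bad-extension (stem k))

      M-increasing : Increasingω M
      -- `M (suc k)` exceeds every entry of `stem (suc k)`, whose head is `M k`.
      M-increasing k = All.head (proj₁ (proj₂ (bad-extension (stem (suc k)))))

      stem≡ : ∀ k → proj₁ (stem k) ≡ applyDownFrom M k
      stem≡ zero    = refl
      stem≡ (suc k) = cong (M k ∷_) (stem≡ k)

      bad⇒⊥ : ⊥
      bad⇒⊥ with k , constant ← continuous M M-increasing =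
        -- Constancy of `G` makes every reservoir homogeneous for `stem k` as it stands.
        proj₂ (stem k) λ H inc _ → H , inc , ⊑-refl , G M ,
          λ Y Y-inc Y≡s _ → constant Y Y-inc (applyDownFrom⇒Agree k (trans Y≡s (stem≡ k)))

  -- Continuous maps into powers of ℕ, compared along tails.

  continuous-≤ᵇ-tail : ∀ {F : Seq → ℕ} → Continuous F → Continuous λ X → F X ≤ᵇ F (tail X)
  continuous-≤ᵇ-tail continuous X inc
    with k , constant  ← continuous X inc
    with l , constant⁻ ← continuous (tail X) (tail-increasing inc) =
    -- Agreement of the tails on `l` entries takes `suc l` entries of the sequences themselves.
    k ⊔ suc l , λ Y Y-inc agree → cong₂ _≤ᵇ_
      (constant Y Y-inc λ i i<k → agree i (<-≤-trans i<k (m≤m⊔n k (suc l))))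
      (constant⁻ (tail Y) (tail-increasing Y-inc) λ i i<l →
        agree (suc i) (<-≤-trans (s≤s i<l) (m≤n⊔m k (suc l))))

  ≤-tail : ∀ {F : Seq → ℕ} → Continuous F → ∀ H → Increasingω H →
           ∃[ H′ ] Increasingω H′ × H′ ⊑ H × (∀ X → Increasingω X → X ⊑ H′ → F X ≤ F (tail X))
  ≤-tail {F} continuous H H-inc =
    by-colour (clopen-ramsey {G} (continuous-≤ᵇ-tail continuous) H H-inc [])
    where
    G : Seq → Bool
    G X = F X ≤ᵇ F (tail X)

    no-descent : ∀ {K} → (∀ X → Increasingω X → X ⊑ K → F (tail X) < F X) →
                 ∀ n X → Increasingω X → X ⊑ K → ¬ F X < n
    no-descent descent (suc n) X inc X⊑K FX<1+n =
      no-descent descent n (tail X) (tail-increasing inc) (tail-⊑ X⊑K)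
        (<-≤-trans (descent X inc X⊑K) (m<1+n⇒m≤n FX<1+n))

    by-colour : (∃[ H′ ] Increasingω H′ × H′ ⊑ H × ∃[ b ] Homogeneous G 0 [] b H′) →
                ∃[ H′ ] Increasingω H′ × H′ ⊑ H ×
                  (∀ X → Increasingω X → X ⊑ H′ → F X ≤ F (tail X))
    by-colour (H′ , inc′ , H′⊑H , true , hom) =
      H′ , inc′ , H′⊑H , λ X inc X⊑H′ →
        ≤ᵇ⇒≤ (F X) (F (tail X)) (subst T (sym (hom X inc refl (drop-0-⊑ {X} X⊑H′))) tt)
    by-colour (H′ , inc′ , H′⊑H , false , hom) = ⊥-elim
      (no-descent (λ X inc X⊑H′ → ≰⇒> λ FX≤ → subst T (hom X inc refl (drop-0-⊑ {X} X⊑H′)) (≤⇒≤ᵇ FX≤))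
        (suc (F H′)) H′ inc′ ⊑-refl (n<1+n (F H′)))

  -- The conclusion speaks of all `X ⊑ H`, so it survives the thinning done for the next coordinate.
  all-≤-tail : ∀ {I : Set} {F : Seq → I → ℕ} → Continuous F → ∀ is →
               ∃[ H ] Increasingω H ×
                 (∀ X → Increasingω X → X ⊑ H → All (λ i → F X i ≤ F (tail X) i) is)
  all-≤-tail continuous []       = id , (λ i → n<1+n i) , λ _ _ _ → []
  all-≤-tail {F = F} continuous (i ∷ is) =
    let H , H-inc , mono            = all-≤-tail {F = F} continuous is
        H′ , H′-inc , H′⊑H , monoᵢ = ≤-tail {λ X → F X i} (continuous-∘ (λ v → v i) continuous) H H-inc
    in H′ , H′-inc , λ X inc X⊑H′ → monoᵢ X inc X⊑H′ ∷ mono X inc (⊑-trans {X} {H′} {H} X⊑H′ H′⊑H)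

  -- From maps on barriers to continuous maps on sequences.

  module Barrier {β : List ℕ → Set} (barrier : IsBarrier β) where
    open IsBarrier barrier

    ⊆⇒⊇ : ∀ {s t} → β s → β t → s List.⊆ t → t List.⊆ s
    ⊆⇒⊇ s∈β t∈β s⊆t {x} x∈t = dne λ x∉s → antichain s∈β t∈β (s⊆t , λ t⊆s → x∉s (t⊆s x∈t))

    -- The empty list is contained in every element of `β`, so by the antichain condition it would
    -- be the only one, and `β` would be finite.
    []∉β : ¬ β []
    []∉β []∈β = infinite ([ [] ] , λ t∈β → here (⊆[]⇒≡[] (⊆⇒⊇ []∈β t∈β λ ())))
      where
      ⊆[]⇒≡[] : ∀ {t : List ℕ} → t List.⊆ [] → t ≡ []
      ⊆[]⇒≡[] {[]}    _    = refl
      ⊆[]⇒≡[] {x ∷ t} t⊆[] with () ← t⊆[] (here refl)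

    ≤⇒applyUpTo-⊆ : ∀ (X : Seq) {k l} → k ≤ l → applyUpTo X k List.⊆ applyUpTo X l
    ≤⇒applyUpTo-⊆ X k≤l x∈ with i , i<k , refl ← ∈-applyUpTo⁻ X x∈ =
      ∈-applyUpTo⁺ X (<-≤-trans i<k k≤l)

    -- If `l < k`, the antichain condition would put `X l` among the first `l` entries of `X`. Used
    -- both ways, this makes the prefix in `β` unique.
    rank-≥ : ∀ {X k l} → Increasingω X → β (applyUpTo X k) → β (applyUpTo X l) → k ≤ l
    rank-≥ {X} {k} {l} inc k∈β l∈β = ≮⇒≥ λ l<k →
      let Xl∈ = ⊆⇒⊇ l∈β k∈β (≤⇒applyUpTo-⊆ X (<⇒≤ l<k)) (∈-applyUpTo⁺ X l<k)
          i , i<l , Xl≡Xi = ∈-applyUpTo⁻ X Xl∈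
      in <-irrefl (sym Xl≡Xi) (increasing⇒<-mono inc i<l)

    -- Were the prefix of `tail X` too short, it would be contained in that of `X`, and the
    -- antichain condition would make `X 0` recur in `tail X`.
    ≪⋆-tail : ∀ {X k l} → Increasingω X → β (applyUpTo X k) → β (applyUpTo (tail X) l) →
              applyUpTo X k ≪⋆ applyUpTo (tail X) l
    ≪⋆-tail {k = zero}          inc k∈β l∈β = []∉β k∈β
    ≪⋆-tail {X} {suc k} {l} inc k∈β l∈β =
      prefix (tail X) (<⇒≤ k<l) ,
      λ eq → <⇒≢ k<l (trans (sym (length-applyUpTo (tail X) k))
                       (trans (cong length eq) (length-applyUpTo (tail X) l)))
      where
      prefix : ∀ (Y : Seq) {k l} → k ≤ l → Prefix _≡_ (applyUpTo Y k) (applyUpTo Y l)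
      prefix Y z≤n       = []
      prefix Y (s≤s k≤l) = refl ∷ prefix (tail Y) k≤l

      k<l : k < l
      k<l = ≰⇒> λ l≤k →
        let X0∈ = ⊆⇒⊇ l∈β k∈β (there ∘ ≤⇒applyUpTo-⊆ (tail X) l≤k) (here refl)
            i , _ , X0≡ = ∈-applyUpTo⁻ (tail X) X0∈
        in <-irrefl X0≡ (increasing⇒<-mono inc (s≤s z≤n))

    module _ {V : Set} (default : V) (f : Σ (List ℕ) β → V) where

      onLists : List ℕ → V
      onLists s with em {β s}
      ... | yes s∈β = f (s , s∈β)
      ... | no  _   = default

      -- `f` may depend on the membership proof, so its value is taken at the proof that `em` picks.
      onLists-∈ : ∀ {s} → β s → ∃[ s∈β ] onLists s ≡ f (s , s∈β)
      onLists-∈ {s} s∈β with em {β s}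
      ... | yes s∈β′ = s∈β′ , refl
      ... | no  s∉β  = contradiction s∈β s∉β

      -- By `bar`, `default` is never reached on an increasing sequence.
      onSeqs : Seq → V
      onSeqs X with em {∃[ k ] β (applyUpTo X k)}
      ... | yes (k , _) = onLists (applyUpTo X k)
      ... | no  _       = default

      onSeqs-prefix : ∀ {X} k → Increasingω X → β (applyUpTo X k) →
                      onSeqs X ≡ onLists (applyUpTo X k)
      onSeqs-prefix {X} k inc k∈β with em {∃[ k ] β (applyUpTo X k)}
      ... | yes (l , l∈β) = cong (onLists ∘ applyUpTo X)
                              (≤-antisym (rank-≥ inc l∈β k∈β) (rank-≥ inc k∈β l∈β))
      ... | no  none      = contradiction (k , k∈β) none

      onSeqs-∈ : ∀ X → Increasingω X →
                 ∃₂ λ k (k∈β : β (applyUpTo X k)) → onSeqs X ≡ f (applyUpTo X k , k∈β)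
      onSeqs-∈ X inc with _ , s∈β , k , refl ← bar X inc
        with s∈β′ , eq ← onLists-∈ s∈β =
        k , s∈β′ , trans (onSeqs-prefix k inc s∈β) eq

      onSeqs-continuous : Continuous onSeqs
      onSeqs-continuous X inc with _ , s∈β , k , refl ← bar X inc =
        k , λ Y Y-inc agree →
          let Y≡X = Agree⇒applyUpTo k agree in
          trans (onSeqs-prefix k Y-inc (subst β (sym Y≡X) s∈β))
            (trans (cong onLists Y≡X) (sym (onSeqs-prefix k inc s∈β)))

  -- No coordinate of `v ∘ f`, read on sequences, drops from `H` to `tail H`; their prefixes in `β`
  -- form the required pair.
  ℕ^-reflecting⇒bqo : ∀ {A I : Set} {_≲_ : Rel A 0ℓ} → IsPreorder _≡_ _≲_ →
    (is : List I) → (∀ i → i ∈ is) →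
    (v : A → I → ℕ) → (∀ x y → (∀ i → v x i ≤ v y i) → x ≲ y) →
    IsBetterQuasiOrdering _≲_
  ℕ^-reflecting⇒bqo isPreorder is complete v reflects = record
    { isPreorder = isPreorder
    ; better     = λ β barrier f →
        let open Barrier barrier
            g = v ∘ f
            z = λ _ → 0
            H , inc , mono = all-≤-tail (onSeqs-continuous z g) is
            k , k∈β , eq₁  = onSeqs-∈ z g H inc
            l , l∈β , eq₂  = onSeqs-∈ z g (tail H) (tail-increasing inc)
        in (_ , k∈β) , (_ , l∈β) , ≪⋆-tail inc k∈β l∈β ,
           reflects _ _ λ i → subst₂ _≤_ (cong (λ w → w i) eq₁) (cong (λ w → w i) eq₂)
                            (All.lookup (mono H inc ⊑-refl) (complete i))
    }

-- Encoding constraints by bounds on sets of variables.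

subsets : ∀ n → List (Subset n)
subsets zero    = [ [] ]
subsets (suc n) = cartesianProductWith _∷_ (inside ∷ outside ∷ []) (subsets n)

∈-subsets : ∀ {n} (p : Subset n) → p ∈ subsets n
∈-subsets []      = here refl
∈-subsets (x ∷ p) = ∈-cartesianProductWith⁺ _∷_ (∈-sides x) (∈-subsets p)
  where
  ∈-sides : ∀ x → x ∈ inside ∷ outside ∷ []
  ∈-sides true  = here refl
  ∈-sides false = there (here refl)

module _ {n : ℕ} where
  open DecMembership (_≟_ {n}) using (_∈?_)

  support : Conjunct n → Subset n
  support c = tabulate λ i → does (i ∈? vars c)

  support-⊆ : ∀ {c c′} → support c ≡ support c′ → vars c List.⊆ vars c′
  support-⊆ {c} {c′} eq {i} i∈c = ∈-does (i ∈? vars c) (i ∈? vars c′) does≡ i∈c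
    where
    does≡ : does (i ∈? vars c) ≡ does (i ∈? vars c′)
    does≡ = trans (sym (lookup∘tabulate _ i))
              (trans (cong (λ p → lookup p i) eq) (lookup∘tabulate _ i))
    ∈-does : ∀ {P Q : Set} (P? : Dec P) (Q? : Dec Q) → does P? ≡ does Q? → P → Q
    ∈-does _       (yes q) _  _ = q
    ∈-does (no ¬p) (no _)  _  p = contradiction p ¬p

  total : Configuration n → Conjunct n → ℕ
  total a c = sum (map (lookup a) (vars c))
    where open import Data.Nat.ListAction using (sum)

  -- Lists of distinct variables with the same elements are permutations of each other.
  support⇒total : ∀ a {c c′} → support c ≡ support c′ → total a c ≡ total a c′
  support⇒total a {c} {c′} eq = sum-↭ (↭-map⁺ (lookup a) (∼bag⇒↭
    (unique∧set⇒bag (distinct c) (distinct c′)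
      (mk⇔ (support-⊆ {c} {c′} eq) (support-⊆ {c′} {c} (sym eq))))))

  _≟ₛ_ : (p q : Subset n) → Dec (p ≡ q)
  _≟ₛ_ = ≡-dec Bool._≟_

  -- The value 0 for a set without conjuncts stands for the vacuous bound.
  strongest : AD n → Subset n → ℕ
  strongest φ p = max 0 (map bound (filter (λ c → support c ≟ₛ p) φ))

  bound≤strongest : ∀ φ {c} → c ∈ φ → bound c ≤ strongest φ (support c)
  bound≤strongest φ {c} c∈φ =
    v≤max⁺ 0 _ (inj₂ (Any.map ≤-reflexive
      (∈-map⁺ bound (∈-filter⁺ (λ c′ → support c′ ≟ₛ support c) c∈φ refl))))

  -- All conjuncts of `φ` with the support of `c` have the total of `c`. The lemma is applied to
  -- `φ₂` with `c` taken from `φ₁`.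
  strongest≤total : ∀ φ {a} → ⟦ φ ⟧ a → ∀ c → strongest φ (support c) ≤ total a c
  strongest≤total φ {a} sat c = max≤v⁺ z≤n (All.map⁺ (All.zipWith
    (λ {c′} (sat′ , eq) → ≤-trans sat′ (≤-reflexive (support⇒total a {c′} {c} eq)))
    (All.filter⁺ same? sat , All.all-filter same? φ)))
    where
    same? = λ c′ → support c′ ≟ₛ support c

  strongest-reflects-≼ : ∀ (φ₁ φ₂ : AD n) → (∀ p → strongest φ₁ p ≤ strongest φ₂ p) → φ₁ ≼ φ₂
  strongest-reflects-≼ φ₁ φ₂ le {a} sat = All.tabulate λ {c} c∈φ₁ →
    ≤-trans (bound≤strongest φ₁ c∈φ₁) (≤-trans (le (support c)) (strongest≤total φ₂ {a} sat c))

  ≼-on-isPreorder : ∀ {A : Set} (g : A → AD n) → IsPreorder _≡_ (_≼_ on g)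
  ≼-on-isPreorder g = record
    { isEquivalence = isEquivalence
    ; reflexive     = λ { refl → id }
    ; trans         = λ x≼y y≼z {a} sat → x≼y {a} (y≼z {a} sat)
    }

theorem8p1 : ExcludedMiddle 0ℓ → ∀ (n : ℕ) → 1 ≤ n →
    IsBetterQuasiOrdering (_≼_ {n}) ×
    IsBetterQuasiOrdering (_≼ᴺᴬ_ {n}) ×
    IsBetterQuasiOrdering (_≼ᴰⱽ_ {n})
theorem8p1 em n _ = bqo id , bqo proj₁ , bqo proj₁
  where
  -- All three orders are pulled back from `AD`, along `id` or `proj₁`, so the encoding composes
  -- with `g`.
  bqo : ∀ {A : Set} (g : A → AD n) → IsBetterQuasiOrdering (_≼_ on g)
  bqo g = Classical.ℕ^-reflecting⇒bqo em (≼-on-isPreorder g)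
            (subsets n) ∈-subsets (strongest ∘ g) (λ x y → strongest-reflects-≼ (g x) (g y))
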